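{- Given an oracle for SAT, the randomized algorithm UniWit, run on a propositional CNF formula $F$ with $n$ propositional variables and an integer $k\ge1$, runs in time polynomial in $|F|$ and $n^{1+1/k}$ relative to the SAT oracle, where $|F|$ denotes the size of $F$.
   Context: "Relative to the SAT oracle" means that each call to the oracle is charged as one step; the oracle, given a propositional formula (a conjunction of CNF clauses and xor constraints), returns a satisfying assignment or reports that none exists. Random bits are available to the algorithm. Hash family. For integers $n,m\ge1$, $a\in\{0,1\}^{n+m-1}$ and $y\in\{0,1\}^n$, the wrapped convolution $a\bullet y\in\{0,1\}^m$ is defined by $(a\bullet y)[i]=\bigoplus_{j=1}^n (y[j]\wedge a[i+j-1])$ for $1\le i\le m$, where $\oplus$ is xor and $v[i]$ is the $i$-th component of a bit-vector $v$. The family $H_{conv}(n,m,2)$ consists of the functions $h_{a,b}:\{0,1\}^n\to\{0,1\}^m$, $h_{a,b}(y)=(a\bullet y)\oplus b$ (componentwise xor), with $a\in\{0,1\}^{n+m-1}$ and $b\in\{0,1\}^m$; choosing a function at random from it means choosing $a,b$ independently and uniformly. BoundedSAT$(G,r)$: for a propositional formula $G$ (a conjunction of CNF clauses and xor constraints) and an integer $r\ge0$, returns a set $S$ of satisfying assignments of $G$ with $|S|=\min(r,\#G)$, where $\#G$ is the number of satisfying assignments of $G$; it is implemented by at most $r$ calls to the SAT oracle (successively excluding the assignments already found). Algorithm UniWit$(F,k)$, where $z_1,\dots,z_n$ are the variables of $F$ (all random choices are uniform and independent): 1. Set $\mathrm{pivot}=\lceil 2n^{1/k}\rceil$ and $S=$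 BoundedSAT$(F,\mathrm{pivot}+1)$. 2. If $|S|\le \mathrm{pivot}$: write $S=\{y_1,\dots,y_{|S|}\}$, choose $j$ at random from $\{1,\dots,|S|\}$ and return $y_j$. 3. Otherwise set $l=\lfloor\frac1k\log_2 n\rfloor$ and $i=l$, and repeat: increase $i$ by $1$; choose $h$ at random from $H_{conv}(n,i-l,2)$; choose $\alpha$ at random from $\{0,1\}^{i-l}$; set $S=$ BoundedSAT$(F\wedge(h(z_1,\dots,z_n)=\alpha),\mathrm{pivot}+1)$; until ($1\le|S|\le\mathrm{pivot}$) or $i=n$. 4. If $|S|>\mathrm{pivot}$ or $|S|<1$, return the failure symbol $\bot$. Otherwise write $S=\{y_1,\dots,y_{|S|}\}$ and choose $j$ at random from $\{1,\dots,\mathrm{pivot}\}$; if $j\le|S|$ return $y_j$, else return $\bot$. -}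

module Defs where

open import Data.Bool.Base using (Bool; true; false; _xor_)
import Data.Bool.Base as Bool
open import Data.Fin.Base using (Fin; toℕ)
open import Data.Integer.Base using (+_)
open import Data.List.Base as List using (List; []; _∷_; length; map; foldr; allFin)
open import Data.List.Relation.Unary.All using (All)
open import Data.List.Relation.Unary.Any using (Any)
open import Data.Maybe.Base as Maybe using (Maybe; just; nothing; maybe)
open import Data.Nat.Base using (ℕ; zero; suc; _+_; _⊔_)
import Data.Nat.Base as ℕ
open import Data.Nat.ListAction using (sum)
open import Data.Product.Base using (_×_; _,_; proj₁; proj₂)
open import Data.Rational.Base as ℚ using (ℚ; 0ℚ)
open import Data.Unit.Base using (⊤; tt)
open import Data.Vec.Base as Vec using (Vec; lookup)
import Data.Vec.Functional as Vector
open import Algebra.Definitions.RawSemiring ℚ.+-*-rawSemiring using (_^_)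
open import Relation.Binary.PropositionalEquality.Core using (_≡_)
open import Relation.Nullary.Negation.Core using (¬_)

------------------------------------------------------------------------
-- Propositional formulas

Literal : ℕ → Set
Literal n = Bool × Fin n              -- (true , v) is v, (false , v) is ¬ v

Clause : ℕ → Set
Clause n = List (Literal n)

CNF : ℕ → Set
CNF n = List (Clause n)

Xor : ℕ → Set
Xor n = List (Fin n) × Bool           -- (v₁ … vₖ , r) is v₁ ⊕ … ⊕ vₖ = r

Formula : ℕ → Set
Formula n = CNF n × List (Xor n)

Assignment : ℕ → Set
Assignment n = Vec Bool n

LiteralHolds : ∀ {n} → Assignment n → Literal n → Set
LiteralHolds y (s , v) = lookup y v ≡ s

XorHolds : ∀ {n} → Assignment n → Xor n → Set
XorHolds y (vs , r) = foldr _xor_ false (map (lookup y) vs) ≡ r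

_⊨_ : ∀ {n} → Assignment n → Formula n → Set
y ⊨ (cs , xs) = All (Any (LiteralHolds y)) cs × All (XorHolds y) xs

-- Occurrences of variables, plus one separator (or right-hand side) for
-- each constraint.
sizeCNF : ∀ {n} → CNF n → ℕ
sizeCNF cs = sum (map (λ c → suc (length c)) cs)

size : ∀ {n} → Formula n → ℕ
size (cs , xs) = sizeCNF cs + sum (map (λ x → suc (length (proj₁ x))) xs)

record SATOracle (n : ℕ) : Set where
  field
    answer   : Formula n → Maybe (Assignment n)
    sound    : ∀ φ {y} → answer φ ≡ just y → y ⊨ φ
    complete : ∀ φ → answer φ ≡ nothing → ∀ y → ¬ (y ⊨ φ)

open SATOracle public using (answer)

------------------------------------------------------------------------
-- Randomized computations with a SAT oracle, and their running time

data Comp (n : ℕ) (A : Set) : Set where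
  return : A → Comp n A
  step   : Comp n A → Comp n A
  flip   : (Bool → Comp n A) → Comp n A                      -- uniform bit
  choose : (N : ℕ) → (Fin (suc N) → Comp n A) → Comp n A     -- uniform in {0,…,N}
  ask    : Formula n → (Maybe (Assignment n) → Comp n A) → Comp n A

infixl 1 _>>=_
_>>=_ : ∀ {n A B} → Comp n A → (A → Comp n B) → Comp n B
return a   >>= f = f a
step c     >>= f = step (c >>= f)
flip c     >>= f = flip (λ b → c b >>= f)
choose N c >>= f = choose N (λ j → c j >>= f)
ask φ c    >>= f = ask φ (λ r → c r >>= f)

-- The worst case over all random choices.  A call to the oracle is one
-- step; writing the query down for it is charged in addition.  A random
-- number in {0,…,N} is delivered in unary, hence its cost.
time : ∀ {n A} → SATOracle n → Comp n A → ℕ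
time O (return _)   = 0
time O (step c)     = 1 + time O c
time O (flip c)     = 1 + (time O (c false) ⊔ time O (c true))
time O (choose N c) = suc N + Vector.foldr _⊔_ 0 (λ j → time O (c j))
time O (ask φ c)    = size φ + 1 + time O (c (answer O φ))

------------------------------------------------------------------------
-- A first-order functional programming language, with every evaluation
-- of a syntax node costing at least one step.  There is no arithmetic:
-- numbers are unary, and each primitive touches a bounded number of
-- constructor cells.

infixr 6 _⇒_
infixr 7 _⊗_

data Ty : Set where
  unit bool nat var : Ty       -- var: the names z₁,…,zₙ, as atoms
  list option       : Ty → Ty
  _⊗_               : Ty → Ty → Ty
  _⇒_               : Ty → Ty → Ty   -- only of the functions bound by recursion

literal clause cnf xorCon assignment : Ty
literal    = bool ⊗ var
clause     = list literal
cnf        = list clause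
xorCon     = list var ⊗ bool
assignment = list bool               -- the values of z₁,…,zₙ in this order

-- Parametric higher-order abstract syntax.  A program is polymorphic in
-- V, so that it can inspect data only by means of the constructs below.

infix  20 `_
infixr 5 _∷_
infix  4 _·_
infix  0 if_then_else_

data Term (V : Ty → Set) : Ty → Set where
  `_    : ∀ {A} → V A → Term V A
  bind  : ∀ {A B} → Term V A → (V A → Term V B) → Term V B
  _·_   : ∀ {A B} → V (A ⇒ B) → Term V A → Term V B

  ⟨⟩    : Term V unit

  true false    : Term V bool
  if_then_else_ : ∀ {A} → Term V bool → Term V A → Term V A → Term V A

  _,_   : ∀ {A B} → Term V A → Term V B → Term V (A ⊗ B)
  split : ∀ {A B C} → Term V (A ⊗ B) → (V A → V B → Term V C) → Term V C

  nothing    : ∀ {A} → Term V (option A)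
  just       : ∀ {A} → Term V A → Term V (option A)
  caseOption : ∀ {A B} → Term V (option A) → Term V B → (V A → Term V B) → Term V B

  zero  : Term V nat
  suc   : Term V nat → Term V nat
  caseℕ : ∀ {A} → Term V nat → Term V A → (V nat → Term V A) → Term V A

  []       : ∀ {A} → Term V (list A)
  _∷_      : ∀ {A} → Term V A → Term V (list A) → Term V (list A)
  caseList : ∀ {A B} → Term V (list A) → Term V B →
             (V A → V (list A) → Term V B) → Term V B

  -- recℕ t s e b applies to the arguments t and s the function f with
  -- f zero s = e s and f (suc m) s = b m s (f m); the call f m is not
  -- made unless b asks for it.  Similarly for lists.
  recℕ    : ∀ {S A} → Term V nat → Term V S → (V S → Term V A) →
            (V nat → V S → V (S ⇒ A) → Term V A) → Term V A
  recList : ∀ {X S A} → Term V (list X) → Term V S → (V S → Term V A) →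
            (V X → V (list X) → V S → V (S ⇒ A) → Term V A) → Term V A

  randomBit     : Term V bool
  randomUpTo    : Term V nat → Term V nat
  sat           : Term V cnf → Term V (list xorCon) → Term V (option assignment)

infixr 0 bind
syntax bind t (λ x → u) = let! x ≔ t ⨾ u

Val : ℕ → Ty → Set
Val n unit       = ⊤
Val n bool       = Bool
Val n nat        = ℕ
Val n var        = Fin n
Val n (list A)   = List (Val n A)
Val n (option A) = Maybe (Val n A)
Val n (A ⊗ B)    = Val n A × Val n B
Val n (A ⇒ B)    = Val n A → Comp n (Val n B)

elimℕ : ∀ {A : Set} → A → (ℕ → A) → ℕ → A
elimℕ e b zero    = e
elimℕ e b (suc m) = b m

elimList : ∀ {X A : Set} → A → (X → List X → A) → List X → A
elimList e b []       = e
elimList e b (x ∷ xs) = b x xs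

iterℕ : ∀ {n} {S A : Set} → (S → Comp n A) →
        (ℕ → S → (S → Comp n A) → Comp n A) → ℕ → S → Comp n A
iterℕ e b zero    s = e s
iterℕ e b (suc m) s = b m s (iterℕ e b m)

iterList : ∀ {n} {X S A : Set} → (S → Comp n A) →
           (X → List X → S → (S → Comp n A) → Comp n A) → List X → S → Comp n A
iterList e b []       s = e s
iterList e b (x ∷ xs) s = b x xs s (iterList e b xs)

eval : ∀ {n A} → Term (Val n) A → Comp n (Val n A)
eval (` x)                  = step (return x)
eval (bind t u)             = step (eval t >>= λ x → eval (u x))
eval (f · t)                = step (eval t >>= f)
eval ⟨⟩                     = step (return tt)
eval true                   = step (return true)
eval false                  = step (return false)
eval (if t then u else v)   = step (eval t >>= λ b → Bool.if b then eval u else eval v)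
eval (t , u)                = step (eval t >>= λ x → eval u >>= λ y → return (x , y))
eval (split t u)            = step (eval t >>= λ p → eval (u (proj₁ p) (proj₂ p)))
eval nothing                = step (return nothing)
eval (just t)               = step (eval t >>= λ x → return (just x))
eval (caseOption t u v)     = step (eval t >>= maybe (λ x → eval (v x)) (eval u))
eval zero                   = step (return zero)
eval (suc t)                = step (eval t >>= λ m → return (suc m))
eval (caseℕ t u v)          = step (eval t >>= elimℕ (eval u) (λ m → eval (v m)))
eval []                     = step (return [])
eval (t ∷ u)                = step (eval t >>= λ x → eval u >>= λ xs → return (x ∷ xs))
eval (caseList t u v)       = step (eval t >>= elimList (eval u) (λ x xs → eval (v x xs)))
eval (recℕ t s e b)         = step (eval t >>= λ m → eval s >>=
                                iterℕ (λ a → eval (e a)) (λ j a f → eval (b j a f)) m)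
eval (recList t s e b)      = step (eval t >>= λ xs → eval s >>=
                                iterList (λ a → eval (e a))
                                         (λ y ys a f → eval (b y ys a f)) xs)
eval randomBit              = flip return
eval (randomUpTo t)         = eval t >>= λ N → choose N (λ j → return (toℕ j))
eval (sat t u)              = eval t >>= λ cs → eval u >>= λ xs →
                                ask (cs , xs) (λ r → return (Maybe.map Vec.toList r))

------------------------------------------------------------------------
-- The algorithm

module Program {V : Ty → Set} where

  notᵇ : Term V bool → Term V bool
  notᵇ b = if b then false else true

  xorᵇ : V bool → V bool → Term V bool
  xorᵇ a b = if ` a then notᵇ (` b) else ` b

  leq : Term V nat → Term V nat → Term V bool
  leq s t = recℕ s t (λ _ → true) λ _ t again →
    caseℕ (` t) false λ t' → again · ` t'

  add : V nat → V nat → Term V nat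
  add s t = recℕ (` s) (` t) (λ t → ` t) λ _ t again → again · suc (` t)

  mul : V nat → V nat → Term V nat
  mul s t = recℕ (` s) zero (λ r → ` r) λ _ r again → again · add t r

  pred : Term V nat → Term V nat
  pred t = caseℕ t zero λ t' → ` t'

  -- Truncated subtraction s ∸ t, in time proportional to the smaller number.
  monus : V nat → V nat → Term V nat
  monus s t = recℕ (` t) (` s) (λ r → ` r) λ _ r again →
    caseℕ (` r) zero λ r' → again · ` r'

  len : ∀ {A} → V (list A) → Term V nat
  len xs = recList (` xs) ⟨⟩ (λ _ → zero) λ _ _ _ again → suc (again · ⟨⟩)

  tail : ∀ {A} → V (list A) → Term V (list A)
  tail xs = caseList (` xs) [] λ _ xs' → ` xs'

  -- Positions are counted from 0.
  nth : ∀ {A} → V (list A) → Term V nat → Term V (option A)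
  nth xs j = recList (` xs) j (λ _ → nothing) λ x _ j again →
    caseℕ (` j) (just (` x)) λ j' → again · ` j'

  -- For p ≥ 2: whether 2ᵏ n ≤ pᵏ, that is, 2 n^(1/k) ≤ p.  Once
  -- 2ʲ n ≤ pʲ for some j ≤ k, the answer is known.
  isRootBound : V nat → V nat → V nat → Term V bool
  isRootBound n k p = recℕ (` k) (suc zero , ` n)
    (λ s → split (` s) λ pʲ 2ʲn → leq (` 2ʲn) (` pʲ))
    λ _ s again → split (` s) λ pʲ 2ʲn →
      if leq (` 2ʲn) (` pʲ)
      then true
      else (again · (mul p pʲ , add 2ʲn 2ʲn))

  -- ⌈2 n^(1/k)⌉ for n, k ≥ 1: this is 2 if n = 1, and otherwise lies in
  -- {3,…,2n}, which is searched from below.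
  ⌈2·_^1/_⌉ : V nat → V nat → Term V nat
  ⌈2· n ^1/ k ⌉ =
    if leq (` n) (suc zero)
    then suc (suc zero)
    else recℕ (add n n) (suc (suc (suc zero))) (λ p → ` p) λ _ p again →
      if isRootBound n k p then ` p else (again · suc (` p))

  ⌊log₂_⌋ : V nat → Term V nat
  ⌊log₂ n ⌋ = recℕ (` n) (suc zero) (λ _ → zero) λ _ 2ᵈ again →
    let! 2ᵈ⁺¹ ≔ add 2ᵈ 2ᵈ ⨾
    if leq (` 2ᵈ⁺¹) (` n) then suc (again · ` 2ᵈ⁺¹) else zero

  ⌊_/_⌋ : V nat → V nat → Term V nat
  ⌊ d / k ⌋ = recℕ (` d) (` d) (λ _ → zero) λ _ r again →
    if leq (` k) (` r) then suc (again · monus r k) else zero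

  randomBits : Term V nat → Term V (list bool)
  randomBits m = recℕ m ⟨⟩ (λ _ → []) λ _ _ again → randomBit ∷ (again · ⟨⟩)

  -- The clause false exactly at the assignment y.
  exclude : V (list var) → V assignment → Term V clause
  exclude zs y = recList (` zs) (` y) (λ _ → []) λ z _ y again →
    caseList (` y) [] λ b y' → (notᵇ (` b) , ` z) ∷ (again · ` y')

  boundedSAT : V (list var) → V cnf → Term V (list xorCon) → Term V nat →
               Term V (list assignment)
  boundedSAT zs G xs r = let! xs ≔ xs ⨾
    recℕ r (` G) (λ _ → []) λ _ G again →
      caseOption (sat (` G) (` xs)) [] λ y →
        ` y ∷ (again · (exclude zs y ∷ ` G))

  -- The variables z_j with a[j] = 1.
  select : V (list var) → V (list bool) → Term V (list var)
  select zs a = recList (` zs) (` a) (λ _ → []) λ z _ a again →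
    caseList (` a) [] λ c a' →
      if ` c then ` z ∷ (again · ` a') else (again · ` a')

  -- h_{a,b}(z₁,…,zₙ) = α.  The i-th constraint is
  -- ⊕_j (z_j ∧ a[i+j-1]) = b[i] ⊕ α[i], for which the first i-1 bits of a
  -- have been dropped.
  hashConstraints : V (list var) → V (list bool) → V (list bool) → V (list bool) →
                    Term V (list xorCon)
  hashConstraints zs a b α = recList (` b) (` a , ` α) (λ _ → []) λ bᵢ _ s again →
    split (` s) λ a α → caseList (` α) [] λ αᵢ α' →
      (select zs a , xorᵇ bᵢ αᵢ) ∷ (again · (tail a , ` α'))

  -- 1 ≤ |S| ≤ pivot
  isGood : V (list assignment) → V nat → Term V bool
  isGood S pivot = let! s ≔ len S ⨾
    if leq (suc zero) (` s) then leq (` s) (` pivot) else false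

  -- zs lists z₁,…,zₙ.  An empty S in the second step yields ⊥.  The loop
  -- state is (i - l , S), and the loop counter is the number n - i of
  -- further rounds possible; n - l ≥ 1 rounds are available at the start.
  uniWit : V (list var) → V cnf → V nat → Term V (option assignment)
  uniWit zs F k =
    let! n     ≔ len zs ⨾
    let! pivot ≔ ⌈2· n ^1/ k ⌉ ⨾
    let! S     ≔ boundedSAT zs F [] (suc (` pivot)) ⨾
    if leq (len S) (` pivot)
    then caseList (` S) nothing (λ _ S' → nth S (randomUpTo (len S')))
    else (
      let! d ≔ ⌊log₂ n ⌋ ⨾
      let! l ≔ ⌊ d / k ⌋ ⨾
      let! S ≔ (recℕ (monus n l) (zero , ` S)
        (λ s → split (` s) λ _ S → ` S)
        λ _ s again → split (` s) λ m _ →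
          let! m ≔ suc (` m) ⨾
          let! a ≔ randomBits (pred (add n m)) ⨾
          let! b ≔ randomBits (` m) ⨾
          let! α ≔ randomBits (` m) ⨾
          let! S ≔ boundedSAT zs F (hashConstraints zs a b α) (suc (` pivot)) ⨾
          if isGood S pivot then ` S else (again · (` m , ` S))) ⨾
      if isGood S pivot
      then nth S (randomUpTo (pred (` pivot)))
      else nothing)

UniWit : ∀ {n} → CNF n → ℕ → Comp n (Maybe (List Bool))
UniWit {n} F k = eval (Program.uniWit {Val n} (allFin n) F k)

------------------------------------------------------------------------
-- The real number n^(1+1/k), given by its rational upper bounds.  By
-- continuity of polynomials, t ≤ p(s, x) for all rational x ≥ n^(1+1/k)
-- gives t ≤ p(s, n^(1+1/k)).

fromℕ : ℕ → ℚ
fromℕ m = + m ℚ./ 1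

-- n^(1+1/k) ≤ q
_^[1+1/_]≤_ : ℕ → ℕ → ℚ → Set
n ^[1+1/ k ]≤ q = 0ℚ ℚ.≤ q × fromℕ (n ℕ.^ suc k) ℚ.≤ q ^ k

{-# OPTIONS --safe #-}
module Submission where

-- The time is bounded by a polynomial in |F| and n alone, uniformly in k;
-- this suffices, because n ≤ n^(1+1/k).  The dependence on k disappears
-- for the following reasons.  The pivot is at most 2n + 3.  The
-- comparisons and subtractions with k stop after at most as many steps
-- as the other operand has units.  In the test 2ᵏ n ≤ pᵏ, where p ≥ 3,
-- the numbers a = pʲ and d = 2ʲ n satisfy d³ ≤ n³ a², so that d > a
-- forces d ≤ n³: the doubling of d ends after polynomially many rounds,
-- however large k is.

open import Defs
open import Data.Bool.Base using (true; false)
open import Data.Fin.Base using (Fin; zero; suc)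
open import Data.List.Base using (List; []; _∷_; length; map; allFin)
open import Data.List.Properties using (length-tabulate)
open import Data.Maybe.Base using (just; nothing)
open import Data.Nat.Base as ℕ using (ℕ; zero; suc; _+_; _*_; _∸_; _⊔_; NonZero)
open import Data.Nat.ListAction using (sum)
import Data.Nat.Properties as ℕ
open import Data.Nat.Tactic.RingSolver using (solve-∀)
open import Data.Product.Base using (Σ-syntax; _×_; _,_; proj₁; proj₂)
open import Data.Rational.Base as ℚ using (ℚ; _≤_; 0ℚ)
import Data.Rational.Properties as ℚ
open import Data.Rational.Solver using (module +-*-Solver)
open import Data.Rational.Unnormalised.Base as ℚᵘ using (mkℚᵘ)
import Data.Rational.Unnormalised.Properties as ℚᵘ
open import Data.Integer.Base as ℤ using (+_)
import Data.Integer.Properties as ℤ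
open import Data.Unit.Base using (⊤; tt)
open import Data.Vec.Base using (Vec; _∷_; []; lookup)
import Data.Vec.Functional as Vector
open import Function.Base using (_∘_; id)
open import Relation.Binary.PropositionalEquality
open import Relation.Nullary.Negation using (contradiction)
open import Relation.Nullary.Reflects using (Reflects; ofʸ; ofⁿ; invert)
open +-*-Solver using (Polynomial; ⟦_⟧; con; var; _:+_; _:*_)
open import Algebra.Definitions.RawSemiring ℚ.+-*-rawSemiring using (_^_)

-- Polynomial bounds, and computations that keep within a time bound

infixl 6 _⊕_
infixl 7 _⊛_

-- Polynomials with natural coefficients in the formula size and the number of variables. Without
-- subtraction every bound is monotone. Being syntax, a bound is fixed before the inputs are, and
-- can be assembled by unification.
data Bound : Set where
  con     : ℕ → Bound
  var     : Fin 2 → Bound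
  _⊕_ _⊛_ : Bound → Bound → Bound

value : Bound → Vec ℕ 2 → ℕ
value (con c) ρ = c
value (var i) ρ = lookup ρ i
value (p ⊕ q) ρ = value p ρ + value q ρ
value (p ⊛ q) ρ = value p ρ * value q ρ

pattern ∣F∣ = var zero
pattern #z  = var (suc zero)

-- An inductive form of the bound on `time` that also carries a postcondition for the result. All
-- random outcomes share one bound, but at a query only the actual answer of `O` is followed. Every
-- node allows slack.
data Within {n A} (O : SATOracle n) (Q : A → Set) : Comp n A → ℕ → Set where
  return : ∀ {a t} → Q a → Within O Q (return a) t
  step   : ∀ {c t u} → Within O Q c t → 1 + t ℕ.≤ u → Within O Q (step c) u
  flip   : ∀ {c t u} → (∀ b → Within O Q (c b) t) → 1 + t ℕ.≤ u →
           Within O Q (flip c) u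
  choose : ∀ {N c t u} → (∀ j → Within O Q (c j) t) → suc N + t ℕ.≤ u →
           Within O Q (choose N c) u
  ask    : ∀ {φ c t u} → Within O Q (c (answer O φ)) t → (size φ + 1) + t ℕ.≤ u →
           Within O Q (ask φ c) u

foldr-⊔-lub : ∀ {N b} (f : Vector.Vector ℕ N) → (∀ j → f j ℕ.≤ b) →
              Vector.foldr _⊔_ 0 f ℕ.≤ b
foldr-⊔-lub {zero}  f f≤b = ℕ.z≤n
foldr-⊔-lub {suc N} f f≤b = ℕ.⊔-lub (f≤b zero) (foldr-⊔-lub (f ∘ suc) (f≤b ∘ suc))

Within⇒time : ∀ {n A O} {Q : A → Set} {c : Comp n A} {t} →
              Within O Q c t → time O c ℕ.≤ t
Within⇒time (return _)   = ℕ.z≤n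
Within⇒time (step w t≤)  = ℕ.≤-trans (ℕ.+-monoʳ-≤ 1 (Within⇒time w)) t≤
Within⇒time (flip w t≤)  =
  ℕ.≤-trans (ℕ.+-monoʳ-≤ 1 (ℕ.⊔-lub (Within⇒time (w false)) (Within⇒time (w true)))) t≤
Within⇒time (choose {N = N} w t≤) =
  ℕ.≤-trans (ℕ.+-monoʳ-≤ (suc N) (foldr-⊔-lub _ (Within⇒time ∘ w))) t≤
Within⇒time (ask {φ = φ} w t≤) = ℕ.≤-trans (ℕ.+-monoʳ-≤ (size φ + 1) (Within⇒time w)) t≤

Within-mono : ∀ {n A O} {P Q : A → Set} {c : Comp n A} {t u} →
              t ℕ.≤ u → (∀ {a} → P a → Q a) → Within O P c t → Within O Q c u
Within-mono t≤u f (return p)   = return (f p)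
Within-mono t≤u f (step w h)   = step (Within-mono ℕ.≤-refl f w) (ℕ.≤-trans h t≤u)
Within-mono t≤u f (flip w h)   = flip (Within-mono ℕ.≤-refl f ∘ w) (ℕ.≤-trans h t≤u)
Within-mono t≤u f (choose w h) = choose (Within-mono ℕ.≤-refl f ∘ w) (ℕ.≤-trans h t≤u)
Within-mono t≤u f (ask w h)    = ask (Within-mono ℕ.≤-refl f w) (ℕ.≤-trans h t≤u)

charge : ∀ a {t u v} → a + t ℕ.≤ u → a + (t + v) ℕ.≤ u + v
charge a {t} {v = v} h = ℕ.≤-trans (ℕ.≤-reflexive (sym (ℕ.+-assoc a t v))) (ℕ.+-monoˡ-≤ v h)

Within->>= : ∀ {n A B O} {P : A → Set} {Q : B → Set} {c : Comp n A} {f t u} →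
             Within O P c t → (∀ {a} → P a → Within O Q (f a) u) →
             Within O Q (c >>= f) (t + u)
Within->>= {t = t} (return p) k = Within-mono (ℕ.m≤n+m _ t) id (k p)
Within->>= (step w h)   k = step (Within->>= w k) (charge 1 h)
Within->>= (flip w h)   k = flip (λ b → Within->>= (w b) k) (charge 1 h)
Within->>= (choose {N = N} w h) k = choose (λ j → Within->>= (w j) k) (charge (suc N) h)
Within->>= (ask {φ = φ} w h)    k = ask (Within->>= w k) (charge (size φ + 1) h)

-- The size of xor constraints, and arithmetic for the root test

xorSize : ∀ {n} → List (Xor n) → ℕ
xorSize xs = sum (map (λ x → suc (length (proj₁ x))) xs)

-- This makes the measure of the root test decrease. The condition `m < o` excludes the case in
-- which truncation makes both differences 0.
∸-monoʳ-<-bounded : ∀ {m k o} → m ℕ.< k → m ℕ.< o → o ∸ k ℕ.< o ∸ m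
∸-monoʳ-<-bounded {zero}  {suc k} {suc o} _ _ = ℕ.s≤s (ℕ.m∸n≤m o k)
∸-monoʳ-<-bounded {suc m} {suc k} {suc o} (ℕ.s≤s m<k) (ℕ.s≤s m<o) =
  ∸-monoʳ-<-bounded m<k m<o

infix 30 _³
_³ : ℕ → ℕ
m ³ = m * m * m

-- Since 2³ ≤ 3², this inequality is invariant under doubling d and
-- multiplying a by p ≥ 3.
cube-invariant : ∀ M d a {p} → 3 ℕ.≤ p → d ³ ℕ.≤ M * (a * a) →
                 (d + d) ³ ℕ.≤ M * (p * a * (p * a))
cube-invariant M d a {p} 3≤p h = begin
  (d + d) ³                  ≡⟨ double d ⟩
  8 * d ³                    ≤⟨ ℕ.*-mono-≤ (ℕ.n≤1+n 8) h ⟩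
  9 * (M * (a * a))          ≡⟨ triple M a ⟩
  M * (3 * a * (3 * a))      ≤⟨ ℕ.*-monoʳ-≤ M (ℕ.*-mono-≤ 3a≤pa 3a≤pa) ⟩
  M * (p * a * (p * a))      ∎
  where
  open ℕ.≤-Reasoning
  3a≤pa = ℕ.*-monoˡ-≤ a 3≤p
  double : ∀ d → (d + d) * (d + d) * (d + d) ≡ 8 * (d * d * d)
  double = solve-∀
  triple : ∀ M a → 9 * (M * (a * a)) ≡ M * (3 * a * (3 * a))
  triple = solve-∀

-- Replacing `a * a` by the larger `d * d` allows `d * d` to be cancelled.
cube-bound : ∀ {M d a} → a ℕ.< d → d ³ ℕ.≤ M * (a * a) → d ℕ.≤ M
cube-bound {M} {d@(suc _)} {a} a<d h = ℕ.*-cancelʳ-≤ d M (d * d) (begin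
  d * (d * d)  ≡⟨ ℕ.*-assoc d d d ⟨
  d ³          ≤⟨ h ⟩
  M * (a * a)  ≤⟨ ℕ.*-monoʳ-≤ M (ℕ.*-mono-≤ (ℕ.<⇒≤ a<d) (ℕ.<⇒≤ a<d)) ⟩
  M * (d * d)  ∎)
  where open ℕ.≤-Reasoning

-- A program logic for running times

module CostLogic {n} (O : SATOracle n) (|F| : ℕ) where

  private variable
    A B C X S : Ty

  ⟪_⟫ : Bound → ℕ
  ⟪ p ⟫ = value p (|F| ∷ n ∷ [])

  infix 4 _≼_

  -- The record wrapper lets unification read off `p`, which cannot be recovered from the number
  -- `⟪ p ⟫`.
  record _≼_ (m : ℕ) (p : Bound) : Set where
    constructor ≼-intro
    field ≼-elim : m ℕ.≤ ⟪ p ⟫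
  open _≼_ public

  -- The time is at most p + r.  Here r is the time allowed for the
  -- recursive call in tail position (if there is one), so that the
  -- costs of branches can be added up without counting it twice.
  record Runs {R : Set} (c : Comp n R) (p : Bound) (r : ℕ) (Q : R → Set) : Set where
    constructor runs
    field within : Within O Q c (⟪ p ⟫ + r)
  open Runs public

  record Costs (t : Term (Val n) A) (p : Bound) (r : ℕ) (Q : Val n A → Set) : Set where
    constructor costs
    field runsᵗ : Runs (eval t) p r Q
  open Costs public

  ≼-trans : ∀ {m k p} → m ℕ.≤ k → k ≼ p → m ≼ p
  ≼-trans m≤k (≼-intro h) = ≼-intro (ℕ.≤-trans m≤k h)

  ≼-con : ∀ {m} → m ≼ con m
  ≼-con = ≼-intro ℕ.≤-refl

  infixl 6 _≼⊕_
  infixl 7 _≼⊛_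

  _≼⊕_ : ∀ {m k p q} → m ≼ p → k ≼ q → m + k ≼ p ⊕ q
  ≼-intro g ≼⊕ ≼-intro h = ≼-intro (ℕ.+-mono-≤ g h)

  _≼⊛_ : ∀ {m k p q} → m ≼ p → k ≼ q → m * k ≼ p ⊛ q
  ≼-intro g ≼⊛ ≼-intro h = ≼-intro (ℕ.*-mono-≤ g h)

  runs-step : ∀ {R c p r} {Q : R → Set} → Runs c p r Q → Runs (step c) (con 1 ⊕ p) r Q
  runs-step (runs w) = runs (step w ℕ.≤-refl)

  runs-weaken : ∀ {R c p q r s} {Q : R → Set} → ⟪ p ⟫ + r ℕ.≤ ⟪ q ⟫ + s →
                Runs c p r Q → Runs c q s Q
  runs-weaken h (runs w) = runs (Within-mono h id w)

  -- Only the second computation may contain the recursive call, so the allowance `r` goes to it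
  -- alone.
  runs-seq : ∀ {R R′ c f p q r} {P : R → Set} {Q : R′ → Set} →
             Runs c p 0 P → (∀ {a} → P a → Runs (f a) q r Q) →
             Runs (c >>= f) (p ⊕ q) r Q
  runs-seq {p = p} {q} {r} (runs w) k = runs (Within-mono
    (ℕ.≤-reflexive (trans (cong (_+ (⟪ q ⟫ + r)) (ℕ.+-identityʳ ⟪ p ⟫))
                          (sym (ℕ.+-assoc ⟪ p ⟫ ⟪ q ⟫ r)))) id
    (Within->>= w (within ∘ k)))

  -- Since `return` is free, a constructor applied to the result of a recursive call leaves that
  -- call entitled to the allowance `r`.
  runs-map : ∀ {R R′ c p r} {f : R → R′} {P : R → Set} {Q : R′ → Set} →
             Runs c p r P → (∀ {a} → P a → Q (f a)) →
             Runs (c >>= λ a → return (f a)) p r Q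
  runs-map (runs w) k = runs (Within-mono (ℕ.≤-reflexive (ℕ.+-identityʳ _)) id
    (Within->>= w (λ p → return {t = 0} (k p))))

  -- `Bound` has no maximum, so each branch of a case distinction is charged with the sum of the
  -- bounds of all branches.
  runs-left : ∀ {R c p q r} {Q : R → Set} → Runs c p r Q → Runs c (p ⊕ q) r Q
  runs-left {p = p} = runs-weaken (ℕ.+-monoˡ-≤ _ (ℕ.m≤m+n ⟪ p ⟫ _))

  runs-right : ∀ {R c p q r} {Q : R → Set} → Runs c q r Q → Runs c (p ⊕ q) r Q
  runs-right {p = p} = runs-weaken (ℕ.+-monoˡ-≤ _ (ℕ.m≤n+m _ ⟪ p ⟫))

  consequence : ∀ {t : Term (Val n) A} {p r} {P Q : Val n A → Set} → (∀ {a} → P a → Q a) →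
                Costs t p r P → Costs t p r Q
  consequence f (costs (runs w)) = costs (runs (Within-mono ℕ.≤-refl f w))

  -- Cost rules for the constructs of the language

  private variable
    r : ℕ
    p q s : Bound
  runs-leaf : ∀ {R} {a : R} {Q : R → Set} → Q a → Runs (step (return a)) (con 1) r Q
  runs-leaf h = runs (step {t = 0} (return h) (ℕ.s≤s ℕ.z≤n))

  costs-` : ∀ {x : Val n A} {Q} → Q x → Costs {A = A} (` x) (con 1) r Q
  costs-` h = costs (runs-leaf h)

  costs-`≡ : ∀ {x : Val n A} → Costs {A = A} (` x) (con 1) r (_≡ x)
  costs-`≡ = costs-` refl

  costs-bind : ∀ {t : Term (Val n) A} {u : Val n A → Term (Val n) B} {P Q} →
               Costs t p 0 P → (∀ {x} → P x → Costs (u x) q r Q) →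
               Costs (bind t u) (con 1 ⊕ (p ⊕ q)) r Q
  costs-bind (costs ht) hu = costs (runs-step (runs-seq ht (runsᵗ ∘ hu)))

  costs-· : ∀ {f : Val n (A ⇒ B)} {t : Term (Val n) A} {P Q} →
            Costs t p 0 P → (∀ {x} → P x → Runs (f x) q r Q) →
            Costs {A = B} (_·_ {A = A} f t) (con 1 ⊕ (p ⊕ q)) r Q
  costs-· (costs ht) hf = costs (runs-step (runs-seq ht hf))

  costs-⟨⟩ : ∀ {Q} → Q tt → Costs ⟨⟩ (con 1) r Q
  costs-⟨⟩ h = costs (runs-leaf h)

  costs-true : ∀ {Q} → Q true → Costs true (con 1) r Q
  costs-true h = costs (runs-leaf h)

  costs-false : ∀ {Q} → Q false → Costs false (con 1) r Q
  costs-false h = costs (runs-leaf h)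

  costs-if : ∀ {t} {u v : Term (Val n) A} {P Q} → Costs t p 0 P →
             (P true → Costs u q r Q) → (P false → Costs v s r Q) →
             Costs (if t then u else v) (con 1 ⊕ (p ⊕ (q ⊕ s))) r Q
  costs-if (costs ht) hu hv = costs (runs-step (runs-seq ht λ
    { {true}  h → runs-left (runsᵗ (hu h)) ; {false} h → runs-right (runsᵗ (hv h)) }))

  costs-, : ∀ {t : Term (Val n) A} {u : Term (Val n) B} {P R Q} →
            Costs t p 0 P → Costs u q r R → (∀ {x y} → P x → R y → Q (x , y)) →
            Costs (t , u) (con 1 ⊕ (p ⊕ q)) r Q
  costs-, (costs ht) (costs hu) k =
    costs (runs-step (runs-seq ht λ h → runs-map hu (k h)))

  costs-split : ∀ {t : Term (Val n) (A ⊗ B)} {u : Val n A → Val n B → Term (Val n) C} {P Q} →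
                Costs t p 0 P → (∀ {x y} → P (x , y) → Costs (u x y) q r Q) →
                Costs (split t u) (con 1 ⊕ (p ⊕ q)) r Q
  costs-split (costs ht) hu = costs (runs-step (runs-seq ht (runsᵗ ∘ hu)))

  costs-× : ∀ {t : Term (Val n) A} {u : Term (Val n) B} {P R} →
            Costs t p 0 P → Costs u q r R →
            Costs (t , u) (con 1 ⊕ (p ⊕ q)) r (λ (x , y) → P x × R y)
  costs-× ht hu = costs-, ht hu _,_

  costs-split-` : ∀ {x : Val n (A ⊗ B)} {u : Val n A → Val n B → Term (Val n) C} {Q} →
                  Costs (u (proj₁ x) (proj₂ x)) q r Q →
                  Costs (split (` x) u) (con 1 ⊕ (con 1 ⊕ q)) r Q
  costs-split-` {x = x} hu = costs-split (costs-` {Q = _≡ x} refl) λ { refl → hu }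

  costs-nothing : ∀ {Q : Val n (option A) → Set} → Q nothing → Costs (nothing {A = A}) (con 1) r Q
  costs-nothing h = costs (runs-leaf h)

  costs-just : ∀ {t : Term (Val n) A} {P Q} → Costs t p r P → (∀ {x} → P x → Q (just x)) →
               Costs (just t) (con 1 ⊕ p) r Q
  costs-just (costs ht) k = costs (runs-step (runs-map ht k))

  costs-caseOption : ∀ {t : Term (Val n) (option A)} {u : Term (Val n) B}
                     {v : Val n A → Term (Val n) B} {P Q} → Costs t p 0 P →
                     (P nothing → Costs u q r Q) → (∀ {x} → P (just x) → Costs (v x) s r Q) →
                     Costs (caseOption t u v) (con 1 ⊕ (p ⊕ (q ⊕ s))) r Q
  costs-caseOption (costs ht) hu hv = costs (runs-step (runs-seq ht λ
    { {nothing} h → runs-left (runsᵗ (hu h)) ; {just _} h → runs-right (runsᵗ (hv h)) }))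

  costs-zero : ∀ {Q} → Q zero → Costs zero (con 1) r Q
  costs-zero h = costs (runs-leaf h)

  costs-zero≡ : Costs zero (con 1) r (_≡ 0)
  costs-zero≡ = costs-zero refl

  costs-suc : ∀ {t P Q} → Costs t p r P → (∀ {m} → P m → Q (suc m)) →
              Costs (suc t) (con 1 ⊕ p) r Q
  costs-suc (costs ht) k = costs (runs-step (runs-map ht k))

  costs-suc≡ : ∀ {t m} → Costs t p r (_≡ m) → Costs (suc t) (con 1 ⊕ p) r (_≡ suc m)
  costs-suc≡ ht = costs-suc ht (cong ℕ.suc)

  costs-caseℕ : ∀ {t} {u : Term (Val n) A} {v P Q} → Costs t p 0 P →
                (P zero → Costs u q r Q) → (∀ {m} → P (suc m) → Costs (v m) s r Q) →
                Costs (caseℕ t u v) (con 1 ⊕ (p ⊕ (q ⊕ s))) r Q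
  costs-caseℕ (costs ht) hu hv = costs (runs-step (runs-seq ht λ
    { {zero} h → runs-left (runsᵗ (hu h)) ; {suc _} h → runs-right (runsᵗ (hv h)) }))

  costs-[] : ∀ {Q : Val n (list A) → Set} → Q [] → Costs ([] {A = A}) (con 1) r Q
  costs-[] h = costs (runs-leaf h)

  costs-∷ : ∀ {t : Term (Val n) A} {u : Term (Val n) (list A)} {P R Q} →
            Costs t p 0 P → Costs u q r R → (∀ {x xs} → P x → R xs → Q (x ∷ xs)) →
            Costs (t ∷ u) (con 1 ⊕ (p ⊕ q)) r Q
  costs-∷ (costs ht) (costs hu) k =
    costs (runs-step (runs-seq ht λ h → runs-map hu (k h)))

  costs-caseList : ∀ {t : Term (Val n) (list A)} {u : Term (Val n) B}
                   {v : Val n A → Val n (list A) → Term (Val n) B} {P Q} → Costs t p 0 P →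
                   (P [] → Costs u q r Q) → (∀ {x xs} → P (x ∷ xs) → Costs (v x xs) s r Q) →
                   Costs (caseList t u v) (con 1 ⊕ (p ⊕ (q ⊕ s))) r Q
  costs-caseList (costs ht) hu hv = costs (runs-step (runs-seq ht λ
    { {[]} h → runs-left (runsᵗ (hu h)) ; {_ ∷ _} h → runs-right (runsᵗ (hv h)) }))

  costs-randomBit : Costs randomBit (con 1) r (λ _ → ⊤)
  costs-randomBit = costs (runs (flip {t = 0} (λ _ → return tt) (ℕ.s≤s ℕ.z≤n)))

  costs-randomUpTo : ∀ {t P} → Costs t p 0 P → (∀ {N} → P N → N ≼ q) →
                     Costs (randomUpTo t) (p ⊕ (con 1 ⊕ q)) r (λ _ → ⊤)
  costs-randomUpTo (costs ht) k = costs (runs-seq ht λ h → runs (choose {t = 0} (λ _ → return tt)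
    (ℕ.s≤s (ℕ.+-mono-≤ (≼-elim (k h)) ℕ.z≤n))))

  costs-sat : ∀ {t u p₁ q₁ P R} → Costs t p 0 P → Costs u q 0 R →
              (∀ {cs} → P cs → sizeCNF cs ≼ p₁) → (∀ {xs} → R xs → xorSize xs ≼ q₁) →
              Costs (sat t u) (p ⊕ (q ⊕ (p₁ ⊕ q₁ ⊕ con 1))) r (λ _ → ⊤)
  costs-sat (costs ht) (costs hu) kt ku = costs (runs-seq ht λ h → runs-seq hu λ h′ →
    runs (ask {t = 0} (return tt)
      (ℕ.+-mono-≤ (ℕ.+-monoˡ-≤ 1 (≼-elim (kt h ≼⊕ ku h′))) ℕ.z≤n)))

  -- The measure μ need only be bounded by a polynomial; the recursion
  -- argument m itself may be arbitrarily large.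
  costs-recℕ-measure :
    ∀ {t} {u : Term (Val n) S} {e : Val n S → Term (Val n) A} {b m c d}
    (μ : ℕ → Val n S → ℕ) (Inv : ℕ → Val n S → Set) (Q : ℕ → Val n A → Set) →
    Costs t p 0 (_≡ m) → Costs u q 0 (λ a → Inv m a × μ m a ≼ s) →
    (∀ {a r} → Inv 0 a → Costs (e a) d r (Q 0)) →
    (∀ {j a f r} → Inv (suc j) a →
      (∀ {a′} → Inv j a′ → μ j a′ ℕ.< μ (suc j) a → Runs (f a′) (con 0) r (Q j)) →
      Costs (b j a f) c r (Q (suc j))) →
    Costs (recℕ t u e b) (con 1 ⊕ (p ⊕ (q ⊕ (d ⊕ (con 1 ⊕ s) ⊛ c)))) r (Q m)
  costs-recℕ-measure {s = s} {e = e} {b} {m} {c} {d} μ Inv Q (costs ht) (costs hu) he hb =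
    costs (runs-step (runs-seq ht λ { refl → runs-seq hu λ (inv , μ≼s) →
      runs-weaken (ℕ.+-monoˡ-≤ _ (ℕ.+-monoʳ-≤ ⟪ d ⟫ (ℕ.*-monoˡ-≤ ⟪ c ⟫ (ℕ.s≤s (≼-elim μ≼s)))))
        (iterate m _ inv ℕ.≤-refl) }))
    where
    regroup : ∀ c d k r → c + (d + k + r) ≡ d + (c + k) + r
    regroup = solve-∀

    -- A round with measure 0 still runs its body, although it can make no further call. Hence a
    -- measure of at most `i` pays for `suc i` rounds.
    iterate : ∀ j i {a r} → Inv j a → μ j a ℕ.≤ i →
              Runs (iterℕ (λ a → eval (e a)) (λ j a f → eval (b j a f)) j a)
                   (d ⊕ con (suc i) ⊛ c) r (Q j)
    -- The entire time of the remaining rounds is put into the allowance. Thus the body sees a call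
    -- of cost 0 and is itself charged only `c`.
    call : ∀ j i {a k r} → Inv j a → μ j a ℕ.< k → k ℕ.≤ i →
           Runs (iterℕ (λ a → eval (e a)) (λ j a f → eval (b j a f)) j a)
                (con 0) (⟪ d ⟫ + i * ⟪ c ⟫ + r) (Q j)
    iterate zero    i inv μ≤i = runs-left (runsᵗ (he inv))
    iterate (suc j) i {r = r} inv μ≤i =
      runs-weaken (ℕ.≤-reflexive (regroup ⟪ c ⟫ ⟪ d ⟫ (i * ⟪ c ⟫) r))
        (runsᵗ (hb inv λ inv′ μ< → call j i inv′ μ< μ≤i))
    call j zero    inv μ< k≤0 = contradiction (ℕ.≤-trans μ< k≤0) λ ()
    call j (suc i) inv μ< k≤i =
      runs-weaken ℕ.≤-refl (iterate j i inv (ℕ.s≤s⁻¹ (ℕ.≤-trans μ< k≤i)))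

  costs-recℕ :
    ∀ {t} {u : Term (Val n) S} {e : Val n S → Term (Val n) A} {b m c d}
    (Inv : ℕ → Val n S → Set) (Q : ℕ → Val n A → Set) →
    m ≼ s → Costs t p 0 (_≡ m) → Costs u q 0 (Inv m) →
    (∀ {a r} → Inv 0 a → Costs (e a) d r (Q 0)) →
    (∀ {j a f r} → Inv (suc j) a → (∀ {a′} → Inv j a′ → Runs (f a′) (con 0) r (Q j)) →
      Costs (b j a f) c r (Q (suc j))) →
    Costs (recℕ t u e b) (con 1 ⊕ (p ⊕ (q ⊕ (d ⊕ (con 1 ⊕ s) ⊛ c)))) r (Q m)
  costs-recℕ Inv Q m≼s ht hu he hb =
    costs-recℕ-measure (λ j _ → j) Inv Q ht (consequence (_, m≼s) hu) he
      λ inv hf → hb inv λ inv′ → hf inv′ ℕ.≤-refl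

  costs-recList :
    ∀ {t : Term (Val n) (list X)} {u : Term (Val n) S} {e : Val n S → Term (Val n) A} {b xs c d}
    (Inv : List (Val n X) → Val n S → Set) (Q : List (Val n X) → Val n A → Set) →
    length xs ≼ s → Costs t p 0 (_≡ xs) → Costs u q 0 (Inv xs) →
    (∀ {a r} → Inv [] a → Costs (e a) d r (Q [])) →
    (∀ {x xs a f r} → Inv (x ∷ xs) a →
      (∀ {a′} → Inv xs a′ → Runs (f a′) (con 0) r (Q xs)) →
      Costs (b x xs a f) c r (Q (x ∷ xs))) →
    Costs (recList t u e b) (con 1 ⊕ (p ⊕ (q ⊕ (d ⊕ s ⊛ c)))) r (Q xs)
  costs-recList {e = e} {b} {xs} {c} {d} Inv Q ∣xs∣≼s (costs ht) (costs hu) he hb =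
    costs (runs-step (runs-seq ht λ { refl → runs-seq hu λ inv →
      runs-weaken (ℕ.+-monoˡ-≤ _ (ℕ.+-monoʳ-≤ ⟪ d ⟫ (ℕ.*-monoˡ-≤ ⟪ c ⟫ (≼-elim ∣xs∣≼s))))
        (iterate xs inv) }))
    where
    regroup : ∀ c d k r → c + (d + k + r) ≡ d + (c + k) + r
    regroup = solve-∀

    iterate : ∀ ys {a r} → Inv ys a →
              Runs (iterList (λ a → eval (e a)) (λ y ys a f → eval (b y ys a f)) ys a)
                   (d ⊕ con (length ys) ⊛ c) r (Q ys)
    iterate []       inv = runs-left (runsᵗ (he inv))
    iterate (y ∷ ys) {r = r} inv =
      runs-weaken (ℕ.≤-reflexive (regroup ⟪ c ⟫ ⟪ d ⟫ (length ys * ⟪ c ⟫) r))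
        (runsᵗ (hb inv λ inv′ → runs-weaken ℕ.≤-refl (iterate ys inv′)))

  -- Running times of the parts of UniWit

  open Program {Val n}

  -- The omitted bounds are those which the cost rules build up.
  costs-leq : ∀ {t u m k} → Costs t p 0 (_≡ m) → Costs u q 0 (_≡ k) → k ≼ s →
              Costs (leq t u) _ r (Reflects (m ℕ.≤ k))
  costs-leq {m = m} {k} ht hu k≼s =
    -- The measure is what remains of the second operand, so the first may be arbitrarily large.
    -- Both operands lose one unit per round, so their difference is invariant.
    costs-recℕ-measure (λ _ k′ → k′) (λ j k′ → j + k ≡ m + k′) (λ _ → Reflects (m ℕ.≤ k))
      ht (consequence (λ { refl → refl , k≼s }) hu)
      (λ eq → costs-true (ofʸ (subst (m ℕ.≤_) (sym eq) (ℕ.m≤m+n m _))))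
      λ {j} eq hf → costs-caseℕ costs-`≡
        (λ { refl → costs-false (ofⁿ (ℕ.<⇒≱
          (subst (k ℕ.<_) (trans eq (ℕ.+-identityʳ m)) (ℕ.m<n+m k ℕ.z<s)))) })
        λ { refl → costs-· costs-`≡ λ { refl →
          hf (ℕ.suc-injective (trans eq (ℕ.+-suc m _))) ℕ.≤-refl } }

  costs-add : ∀ {m k} → m ≼ s → Costs (add m k) _ r (_≡ m + k)
  costs-add {m = m} {k} m≼s =
    costs-recℕ (λ j k′ → j + k′ ≡ m + k) (λ _ → _≡ m + k) m≼s costs-`≡ (costs-` refl) costs-`
      λ eq hf → costs-· (costs-suc≡ costs-`≡) λ { refl → hf (trans (ℕ.+-suc _ _) eq) }

  costs-mul : ∀ {m k} → m ≼ p → k ≼ q → Costs (mul m k) _ r (_≡ m * k)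
  costs-mul {m = m} {k} m≼p k≼q =
    costs-recℕ (λ j a → j * k + a ≡ m * k) (λ _ → _≡ m * k)
      m≼p costs-`≡ (costs-zero (ℕ.+-identityʳ _)) costs-`
      λ {j} {a} eq hf → costs-· (costs-add k≼q) λ { refl →
        hf (trans (trans (sym (ℕ.+-assoc (j * k) k a)) (cong (_+ a) (ℕ.+-comm (j * k) k))) eq) }

  costs-pred : ∀ {t m} → Costs t p 0 (_≡ m) → Costs (pred t) _ r (_≡ ℕ.pred m)
  costs-pred ht = costs-caseℕ ht (λ eq → costs-zero (cong ℕ.pred eq)) λ eq → costs-` (cong ℕ.pred eq)

  costs-monus : ∀ {m k} → m ≼ s → Costs (monus m k) _ r (_≡ m ∸ k)
  costs-monus {m = m} {k} m≼s =
    -- The recursion is on the subtrahend, but the minuend is the measure; a huge `k` does no harm.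
    costs-recℕ-measure (λ _ m′ → m′) (λ j m′ → m′ ∸ j ≡ m ∸ k) (λ _ → _≡ m ∸ k)
      costs-`≡ (costs-` (refl , m≼s)) costs-`
      λ eq hf → costs-caseℕ costs-`≡ (λ { refl → costs-zero eq })
        λ { refl → costs-· costs-`≡ λ { refl → hf eq ℕ.≤-refl } }

  costs-len : ∀ {xs : List (Val n A)} → length xs ≼ s → Costs (len {A = A} xs) _ r (_≡ length xs)
  costs-len ∣xs∣≼s =
    costs-recList (λ _ _ → ⊤) (λ xs → _≡ length xs) ∣xs∣≼s costs-`≡ (costs-⟨⟩ tt)
      (λ _ → costs-zero refl)
      λ _ hf → costs-suc (costs-· (costs-⟨⟩ tt) hf) (cong ℕ.suc)

  costs-tail : ∀ {xs : List (Val n A)} → Costs (tail {A = A} xs) _ r (λ _ → ⊤)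
  costs-tail = costs-caseList costs-`≡ (λ _ → costs-[] tt) λ _ → costs-` tt

  costs-nth : ∀ {xs : List (Val n A)} {t P} → length xs ≼ s → Costs t p 0 P →
              Costs (nth {A = A} xs t) _ r (λ _ → ⊤)
  costs-nth ∣xs∣≼s ht =
    costs-recList (λ _ _ → ⊤) (λ _ _ → ⊤) ∣xs∣≼s costs-`≡ (consequence (λ _ → tt) ht)
      (λ _ → costs-nothing tt)
      λ _ hf → costs-caseℕ costs-`≡ (λ _ → costs-just costs-`≡ λ _ → tt) λ _ → costs-· costs-`≡ λ _ → hf tt


  -- Root, logarithm and quotient

  private variable
    m k : ℕ
    zs : List (Fin n)

  -- The exponent `l` is unrestricted. A failed test means `a < d`, which by the cubic invariant
  -- forces `d ≤ m ³`, and each further round doubles `d`.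
  costs-isRootBound : 3 ℕ.≤ k → m ≼ p → k ≼ q → ∀ {l} →
                      Costs (isRootBound m l k) _ r (λ _ → ⊤)
  costs-isRootBound {k = k} {m} {p} {q} 3≤k m≼p k≼q =
    -- The distance of `d` from `m ³`, with `suc` so that it is still positive at `d = m ³`. A
    -- decrease by one per round is enough for a polynomial bound.
    costs-recℕ-measure (λ _ (_ , d) → suc (m ³) ∸ d)
      -- The bound on `a` covers the initial value 1 and the later values: `a` is multiplied by `k`
      -- only while `a < d ≤ m ³`, which gives at most `k * m ³`.
      (λ _ (a , d) → d ³ ℕ.≤ m ³ * (a * a) × a ≼ con 1 ⊕ q ⊛ (p ⊛ p ⊛ p))
      (λ _ _ → ⊤) costs-`≡
      (consequence (λ { (refl , refl) →
        (ℕ.≤-reflexive (sym (ℕ.*-identityʳ _)) , ≼-intro (ℕ.s≤s ℕ.z≤n)) ,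
        ≼-trans (ℕ.m∸n≤m _ m) (≼-con {1} ≼⊕ m³≼) })
        (costs-× (costs-suc≡ costs-zero≡) costs-`≡))
      (λ (_ , a≼) → costs-split-` (consequence (λ _ → tt) (costs-leq costs-`≡ costs-`≡ a≼)))
      λ {_} {(a , d)} (d³≤ , a≼) hf → costs-split-`
        (costs-if (costs-leq costs-`≡ costs-`≡ a≼) (λ _ → costs-true tt) λ d≰a →
          let a<d = ℕ.≰⇒> (invert d≰a)
              d≤m³ = cube-bound a<d d³≤
          in costs-·
            (costs-× (costs-mul k≼q a≼) (costs-add (≼-trans d≤m³ m³≼)))
            λ { (refl , refl) → hf
              ( cube-invariant (m ³) d a 3≤k d³≤
              , ≼-trans (ℕ.≤-trans (ℕ.*-monoʳ-≤ k (ℕ.≤-trans (ℕ.<⇒≤ a<d) d≤m³)) (ℕ.n≤1+n _))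
                  (≼-con {1} ≼⊕ k≼q ≼⊛ m³≼))
              (∸-monoʳ-<-bounded (ℕ.m<m+n _ (ℕ.≤-trans (ℕ.s≤s ℕ.z≤n) a<d)) (ℕ.s≤s d≤m³)) })
    where
    m³≼ = m≼p ≼⊛ m≼p ≼⊛ m≼p

  costs-⌈2·^1/⌉ : m ≼ p → Costs (⌈2· m ^1/ k ⌉) _ r (_≼ p ⊕ p ⊕ con 3)
  costs-⌈2·^1/⌉ {m = m} {p} m≼p =
    costs-if (costs-leq costs-`≡ (costs-suc≡ costs-zero≡) ≼-con)
      (λ _ → costs-suc (costs-suc≡ costs-zero≡) λ { refl →
        ≼-intro (ℕ.≤-trans (ℕ.n≤1+n 2) (ℕ.m≤n+m 3 _)) })
      -- Each round trades one unit of the counter for one unit of the candidate, which therefore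
      -- stays at most `m + m + 3` whether or not the search succeeds. The root test asks for
      -- `3 ≤ a`.
      λ _ → costs-recℕ (λ j a → 3 ℕ.≤ a × j + a ℕ.≤ m + m + 3) (λ _ → _≼ p ⊕ p ⊕ con 3)
        (m≼p ≼⊕ m≼p) (costs-add m≼p)
        (costs-suc (costs-suc≡ (costs-suc≡ costs-zero≡)) λ { refl →
          ℕ.≤-refl , ℕ.≤-refl })
        (λ (_ , a≤) → costs-` (≼-trans a≤ bound))
        λ {j} (3≤a , j+a≤) hf →
          let a≼ = ≼-trans (ℕ.≤-trans (ℕ.m≤n+m _ (suc j)) j+a≤) bound
          in costs-if (costs-isRootBound 3≤a m≼p a≼) (λ _ → costs-` a≼)
            λ _ → costs-· (costs-suc≡ costs-`≡) λ { refl →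
              hf (ℕ.m≤n⇒m≤1+n 3≤a , ℕ.≤-trans (ℕ.≤-reflexive (ℕ.+-suc j _)) j+a≤) }
    where
    bound = m≼p ≼⊕ m≼p ≼⊕ ≼-con {3}

  costs-⌊log₂⌋ : m ≼ p → Costs (⌊log₂ m ⌋) _ r (ℕ._≤ m)
  costs-⌊log₂⌋ {p = p} m≼p =
    -- A doubled power is passed on only after it has been found to be at most `m`. The summand 1
    -- covers the initial power.
    costs-recℕ (λ _ → _≼ con 1 ⊕ p) (λ j → ℕ._≤ j) m≼p costs-`≡
      (costs-suc costs-zero≡ λ { refl → ≼-trans (ℕ.s≤s ℕ.z≤n) (≼-con {1} ≼⊕ m≼p) })
      (λ _ → costs-zero ℕ.z≤n)
      λ a≼ hf → costs-bind (costs-add a≼) λ { refl →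
        costs-if (costs-leq costs-`≡ costs-`≡ m≼p)
          (λ 2a≤m → costs-suc
            (costs-· costs-`≡ λ { refl →
              hf (≼-trans (ℕ.m≤n⇒m≤1+n (invert 2a≤m)) (≼-con {1} ≼⊕ m≼p)) }) ℕ.s≤s)
          λ _ → costs-zero ℕ.z≤n }

  costs-⌊/⌋ : m ≼ p → Costs (⌊ m / k ⌋) _ r (λ _ → ⊤)
  costs-⌊/⌋ {p = p} {k = k} m≼p =
    -- Only the remainder has to stay bounded: comparison with the divisor `k` and subtraction of it
    -- are both paid for by the remainder.
    costs-recℕ (λ _ → _≼ p) (λ _ _ → ⊤) m≼p costs-`≡ (costs-` m≼p) (λ _ → costs-zero tt)
      λ {_} {a} a≼ hf → costs-if (costs-leq costs-`≡ costs-`≡ a≼)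
        (λ _ → costs-suc (costs-· (costs-monus a≼) λ { refl → hf (≼-trans (ℕ.m∸n≤m a k) a≼) })
          λ _ → tt)
        λ _ → costs-zero tt

  -- Random bits, bounded enumeration and hash constraints

  costs-randomBits : ∀ {t} → m ≼ q → Costs t p 0 (_≡ m) →
                     Costs (randomBits t) _ r (λ bs → length bs ≡ m)
  costs-randomBits m≼q ht =
    costs-recℕ (λ _ _ → ⊤) (λ j bs → length bs ≡ j) m≼q ht (costs-⟨⟩ tt)
      (λ _ → costs-[] refl)
      λ _ hf → costs-∷ costs-randomBit (costs-· (costs-⟨⟩ tt) hf) λ _ → cong ℕ.suc

  costs-notᵇ : ∀ {t P} → Costs t p 0 P → Costs (notᵇ t) _ r (λ _ → ⊤)
  costs-notᵇ ht = costs-if ht (λ _ → costs-false tt) λ _ → costs-true tt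

  costs-xorᵇ : ∀ {a b} → Costs (xorᵇ a b) _ r (λ _ → ⊤)
  costs-xorᵇ = costs-if costs-`≡ (λ _ → costs-notᵇ costs-`≡) λ _ → costs-` tt

  costs-exclude : ∀ {y} → length zs ≼ p →
                  Costs (exclude zs y) _ r (λ c → length c ℕ.≤ length zs)
  costs-exclude ∣zs∣≼p =
    costs-recList (λ _ _ → ⊤) (λ zs c → length c ℕ.≤ length zs) ∣zs∣≼p costs-`≡ (costs-` tt)
      (λ _ → costs-[] ℕ.z≤n)
      λ _ hf → costs-caseList costs-`≡ (λ _ → costs-[] ℕ.z≤n) λ _ →
        costs-∷ (costs-, {Q = λ _ → ⊤} (costs-notᵇ costs-`≡) costs-`≡ λ _ _ → tt)
          (costs-· costs-`≡ λ _ → hf tt) λ _ → ℕ.s≤s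

  costs-boundedSAT : ∀ {G t u p₁ q₁ s₁} → length zs ≼ p → sizeCNF G ≼ q → m ≼ s →
                     Costs t p₁ 0 (λ xs → xorSize xs ≼ q₁) → Costs u s₁ 0 (_≡ m) →
                     Costs (boundedSAT zs G t u) _ r (λ S → length S ℕ.≤ m)
  costs-boundedSAT {zs = zs} {p} {q} {m} {s} {G} ∣zs∣≼p ∣G∣≼q m≼s ht hu =
    costs-bind ht λ ∣xs∣≼ →
      -- The current formula is counted together with a reserve for the exclusion clauses of the `j`
      -- queries left, each of size at most `suc (length zs)`. Adding a clause draws on the reserve,
      -- so the total never grows.
      costs-recℕ (λ j G → sizeCNF G + j * suc (length zs) ≼ q ⊕ s ⊛ (con 1 ⊕ p))
        (λ j S → length S ℕ.≤ j) m≼s hu (costs-` (∣G∣≼q ≼⊕ m≼s ≼⊛ (≼-con {1} ≼⊕ ∣zs∣≼p)))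
        (λ _ → costs-[] ℕ.z≤n)
        λ {j} {G} G≼ hf →
          costs-caseOption
            (costs-sat costs-`≡ costs-`≡ (λ { refl → ≼-trans (ℕ.m≤m+n _ _) G≼ }) λ { refl → ∣xs∣≼ })
            (λ _ → costs-[] ℕ.z≤n)
            λ _ → costs-∷ costs-`≡
              (costs-·
                (costs-∷ {Q = λ G′ → sizeCNF G′ ℕ.≤ suc (length zs) + sizeCNF G}
                  (costs-exclude ∣zs∣≼p) costs-`≡
                  λ { ∣c∣≤ refl → ℕ.+-monoˡ-≤ (sizeCNF G) (ℕ.s≤s ∣c∣≤) })
                λ G′≤ → hf (≼-trans
                  (ℕ.≤-trans (ℕ.+-monoˡ-≤ (j * suc (length zs)) G′≤)
                    (ℕ.≤-reflexive (regroup (suc (length zs)) (sizeCNF G) (j * suc (length zs)))))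
                  G≼))
              λ _ → ℕ.s≤s
    where
    regroup : ∀ a b c → a + b + c ≡ b + (a + c)
    regroup = solve-∀

  costs-select : ∀ {a} → length zs ≼ p →
                 Costs (select zs a) _ r (λ vs → length vs ℕ.≤ length zs)
  costs-select ∣zs∣≼p =
    costs-recList (λ _ _ → ⊤) (λ zs vs → length vs ℕ.≤ length zs) ∣zs∣≼p costs-`≡ (costs-` tt)
      (λ _ → costs-[] ℕ.z≤n)
      λ _ hf → costs-caseList costs-`≡ (λ _ → costs-[] ℕ.z≤n) λ _ →
        costs-if costs-`≡
          (λ _ → costs-∷ costs-`≡ (costs-· costs-`≡ λ _ → hf tt) λ _ → ℕ.s≤s)
          λ _ → consequence ℕ.m≤n⇒m≤1+n (costs-· costs-`≡ λ _ → hf tt)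

  -- There is at most one constraint per bit of `b`, with at most `length zs` variables and one unit
  -- for the right-hand side; the lengths of `a` and `α` do not enter.
  costs-hashConstraints : ∀ {a b α} → length zs ≼ p → length b ≼ q →
                          Costs (hashConstraints zs a b α) _ r (λ xs → xorSize xs ≼ q ⊛ (con 1 ⊕ p))
  costs-hashConstraints {zs = zs} ∣zs∣≼p ∣b∣≼q =
    consequence (λ h → ≼-trans h (∣b∣≼q ≼⊛ (≼-con {1} ≼⊕ ∣zs∣≼p)))
      (costs-recList (λ _ _ → ⊤) (λ b xs → xorSize xs ℕ.≤ length b * suc (length zs))
        ∣b∣≼q costs-`≡ (costs-, costs-`≡ costs-`≡ λ _ _ → tt)
        (λ _ → costs-[] ℕ.z≤n)
        λ _ hf → costs-split-`
          (costs-caseList costs-`≡ (λ _ → costs-[] ℕ.z≤n) λ _ →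
            costs-∷ {P = λ (vs , _) → length vs ℕ.≤ length zs}
              (costs-, (costs-select ∣zs∣≼p) costs-xorᵇ λ h _ → h)
              (costs-· (costs-, {Q = λ _ → ⊤} costs-tail costs-`≡ λ _ _ → tt) hf)
              λ h h′ → ℕ.+-mono-≤ (ℕ.s≤s h) h′))

  costs-isGood : ∀ {S} → length S ≼ p → m ≼ q → Costs (isGood S m) _ r (λ _ → ⊤)
  costs-isGood ∣S∣≼p m≼q =
    costs-bind (costs-len ∣S∣≼p) λ { refl →
      costs-if (costs-leq (costs-suc≡ costs-zero≡) costs-`≡ ∣S∣≼p)
        (λ _ → consequence (λ _ → tt) (costs-leq costs-`≡ costs-`≡ m≼q))
        λ _ → costs-false tt }

  -- The whole algorithm

  costs-uniWit : ∀ {F} → length zs ≼ #z → sizeCNF F ≼ ∣F∣ →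
                 Costs (uniWit zs F k) _ r (λ _ → ⊤)
  costs-uniWit {zs = zs} ∣zs∣≼n F≼ =
    costs-bind (costs-len ∣zs∣≼n) λ { refl →
    costs-bind (costs-⌈2·^1/⌉ ∣zs∣≼n) λ {pivot} pivot≼ →
    let r≼ = ≼-con {1} ≼⊕ pivot≼ in
    costs-bind (costs-boundedSAT ∣zs∣≼n F≼ r≼ (costs-[] (≼-con {0})) (costs-suc≡ costs-`≡)) λ ∣S∣≤ →
    let ∣S∣≼ = ≼-trans ∣S∣≤ r≼ in
    costs-if (costs-leq (costs-len ∣S∣≼) costs-`≡ pivot≼)
      (λ _ → costs-caseList costs-`≡ (λ _ → costs-nothing tt) λ { refl →
        let ∣S′∣≼ = ≼-trans (ℕ.n≤1+n _) ∣S∣≼ in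
        costs-nth ∣S∣≼ (costs-randomUpTo (costs-len ∣S′∣≼) λ { refl → ∣S′∣≼ }) })
      λ _ →
        costs-bind (costs-⌊log₂⌋ ∣zs∣≼n) λ d≤n →
        costs-bind (costs-⌊/⌋ (≼-trans d≤n ∣zs∣≼n)) λ {l} _ →
        costs-bind
          (costs-recℕ
            -- j rounds are left and m = i - l rounds are done.
            (λ j (m , S) → j + m ℕ.≤ length zs × length S ℕ.≤ suc pivot)
            (λ _ S → length S ℕ.≤ suc pivot)
            (≼-trans (ℕ.m∸n≤m (length zs) l) ∣zs∣≼n) (costs-monus ∣zs∣≼n)
            (costs-, costs-zero≡ costs-`≡ λ { refl refl →
              ℕ.≤-trans (ℕ.≤-reflexive (ℕ.+-identityʳ _)) (ℕ.m∸n≤m _ l) , ∣S∣≤ })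
            (λ (_ , ∣S∣≤) → costs-split-` (costs-` ∣S∣≤))
            λ {j} {(m , _)} (1+j+m≤n , _) hf → costs-split-` (
              -- This round uses a hash value of `1 + m` bits; the invariant keeps that length at
              -- most the number of variables.
              let j+1+m≤n = ℕ.≤-trans (ℕ.≤-reflexive (ℕ.+-suc j m)) 1+j+m≤n
                  1+m≼ = ≼-trans (ℕ.≤-trans (ℕ.m≤n+m _ j) j+1+m≤n) ∣zs∣≼n
              in
              costs-bind (costs-suc≡ costs-`≡) λ { refl →
              costs-bind (costs-randomBits
                (≼-trans ℕ.pred[n]≤n (∣zs∣≼n ≼⊕ 1+m≼)) (costs-pred (costs-add ∣zs∣≼n))) λ _ →
              costs-bind (costs-randomBits 1+m≼ costs-`≡) λ ∣b∣≡ →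
              costs-bind (costs-randomBits 1+m≼ costs-`≡) λ _ →
              costs-bind (costs-boundedSAT ∣zs∣≼n F≼ r≼
                (costs-hashConstraints ∣zs∣≼n (subst (_≼ _) (sym ∣b∣≡) 1+m≼))
                (costs-suc≡ costs-`≡)) λ ∣S∣≤ →
              costs-if (costs-isGood (≼-trans ∣S∣≤ r≼) pivot≼) (λ _ → costs-` ∣S∣≤) λ _ →
                costs-· (costs-× costs-`≡ costs-`≡) λ { (refl , refl) → hf (j+1+m≤n , ∣S∣≤) } }))
          λ ∣S∣≤ →
            let ∣S∣≼ = ≼-trans ∣S∣≤ r≼ in
            costs-if (costs-isGood ∣S∣≼ pivot≼)
              (λ _ → costs-nth ∣S∣≼ (costs-randomUpTo (costs-pred costs-`≡) λ { refl →
                ≼-trans ℕ.pred[n]≤n pivot≼ }))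
              λ _ → costs-nothing tt }

-- From natural to rational bounds

-- The reduction to lowest terms in `ℚ` does not compute on variables, so the identity is checked on
-- unnormalised fractions with denominator 1.
fromℕ-+ : ∀ a b → fromℕ (a + b) ≡ fromℕ a ℚ.+ fromℕ b
fromℕ-+ a b = ℚ.toℚᵘ-injective (begin
  ℚ.toℚᵘ (fromℕ (a + b))                   ≈⟨ ℚ.toℚᵘ-fromℚᵘ (mkℚᵘ (+ (a + b)) 0) ⟩
  mkℚᵘ (+ (a + b)) 0                       ≡⟨ cong (λ i → mkℚᵘ i 0) +-identity ⟨
  mkℚᵘ (+ a) 0 ℚᵘ.+ mkℚᵘ (+ b) 0           ≈⟨ ℚᵘ.+-cong (ℚ.toℚᵘ-fromℚᵘ (mkℚᵘ (+ a) 0))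
                                                         (ℚ.toℚᵘ-fromℚᵘ (mkℚᵘ (+ b) 0)) ⟨
  ℚ.toℚᵘ (fromℕ a) ℚᵘ.+ ℚ.toℚᵘ (fromℕ b)   ≈⟨ ℚ.toℚᵘ-homo-+ (fromℕ a) (fromℕ b) ⟨
  ℚ.toℚᵘ (fromℕ a ℚ.+ fromℕ b)             ∎)
  where
  open ℚᵘ.≃-Reasoning
  +-identity = cong₂ ℤ._+_ (ℤ.*-identityʳ (+ a)) (ℤ.*-identityʳ (+ b))

fromℕ-* : ∀ a b → fromℕ (a * b) ≡ fromℕ a ℚ.* fromℕ b
fromℕ-* a b = ℚ.toℚᵘ-injective (begin
  ℚ.toℚᵘ (fromℕ (a * b))                   ≈⟨ ℚ.toℚᵘ-fromℚᵘ (mkℚᵘ (+ (a * b)) 0) ⟩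
  mkℚᵘ (+ (a * b)) 0                       ≡⟨ cong (λ i → mkℚᵘ i 0) (ℤ.pos-* a b) ⟩
  mkℚᵘ (+ a) 0 ℚᵘ.* mkℚᵘ (+ b) 0           ≈⟨ ℚᵘ.*-cong (ℚ.toℚᵘ-fromℚᵘ (mkℚᵘ (+ a) 0))
                                                         (ℚ.toℚᵘ-fromℚᵘ (mkℚᵘ (+ b) 0)) ⟨
  ℚ.toℚᵘ (fromℕ a) ℚᵘ.* ℚ.toℚᵘ (fromℕ b)   ≈⟨ ℚ.toℚᵘ-homo-* (fromℕ a) (fromℕ b) ⟨
  ℚ.toℚᵘ (fromℕ a ℚ.* fromℕ b)             ∎)
  where open ℚᵘ.≃-Reasoning

fromℕ-nonNeg : ∀ m → ℚ.NonNegative (fromℕ m)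
fromℕ-nonNeg m = ℚ.normalize-nonNeg m 1

fromℕ-mono : ∀ {m k} → m ℕ.≤ k → fromℕ m ≤ fromℕ k
fromℕ-mono {m} {k} m≤k = begin
  fromℕ m                      ≡⟨ ℚ.+-identityʳ _ ⟨
  fromℕ m ℚ.+ 0ℚ               ≤⟨ ℚ.+-monoʳ-≤ (fromℕ m) (ℚ.nonNegative⁻¹ _ {{fromℕ-nonNeg (k ∸ m)}}) ⟩
  fromℕ m ℚ.+ fromℕ (k ∸ m)    ≡⟨ fromℕ-+ m (k ∸ m) ⟨
  fromℕ (m + (k ∸ m))          ≡⟨ cong fromℕ (ℕ.m+[n∸m]≡n m≤k) ⟩
  fromℕ k                      ∎
  where open ℚ.≤-Reasoning

toPolynomial : Bound → Polynomial 2
toPolynomial (con c) = con (fromℕ c)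
toPolynomial (var i) = var i
toPolynomial (p ⊕ q) = toPolynomial p :+ toPolynomial q
toPolynomial (p ⊛ q) = toPolynomial p :* toPolynomial q

-- Monotonicity holds because all coefficients are natural numbers. In a product, the factor at `σ`
-- is nonnegative since it lies above a natural number.
value≤⟦toPolynomial⟧ : ∀ p {ρ σ} → (∀ i → fromℕ (lookup ρ i) ≤ lookup σ i) →
                       fromℕ (value p ρ) ≤ ⟦ toPolynomial p ⟧ σ
value≤⟦toPolynomial⟧ (con c) ρ≤σ = ℚ.≤-refl
value≤⟦toPolynomial⟧ (var i) ρ≤σ = ρ≤σ i
value≤⟦toPolynomial⟧ (p ⊕ q) {ρ} ρ≤σ =
  ℚ.≤-trans (ℚ.≤-reflexive (fromℕ-+ (value p ρ) (value q ρ)))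
    (ℚ.+-mono-≤ (value≤⟦toPolynomial⟧ p ρ≤σ) (value≤⟦toPolynomial⟧ q ρ≤σ))
value≤⟦toPolynomial⟧ (p ⊛ q) {ρ} {σ} ρ≤σ = begin
  fromℕ (value p ρ * value q ρ)                ≡⟨ fromℕ-* (value p ρ) (value q ρ) ⟩
  fromℕ (value p ρ) ℚ.* fromℕ (value q ρ)      ≤⟨ ℚ.*-monoʳ-≤-nonNeg (fromℕ (value q ρ)) {{fromℕ-nonNeg (value q ρ)}} p≤ ⟩
  P ℚ.* fromℕ (value q ρ)                      ≤⟨ ℚ.*-monoˡ-≤-nonNeg P {{P-nonNeg}} (value≤⟦toPolynomial⟧ q ρ≤σ) ⟩
  P ℚ.* ⟦ toPolynomial q ⟧ σ                   ∎
  where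
  open ℚ.≤-Reasoning
  P = ⟦ toPolynomial p ⟧ σ
  p≤ = value≤⟦toPolynomial⟧ p ρ≤σ
  P-nonNeg = ℚ.nonNegative (ℚ.≤-trans (ℚ.nonNegative⁻¹ _ {{fromℕ-nonNeg (value p ρ)}}) p≤)

-- Comparison of n with n^(1+1/k)

^-≤-fromℕ : ∀ {n x} → 0ℚ ≤ x → x ≤ fromℕ n → ∀ k → x ^ k ≤ fromℕ (n ℕ.^ k)
^-≤-fromℕ 0≤x x≤n zero = ℚ.≤-refl
^-≤-fromℕ {n} {x} 0≤x x≤n (suc k) = begin
  x ℚ.* x ^ k                     ≤⟨ ℚ.*-monoˡ-≤-nonNeg x {{ℚ.nonNegative 0≤x}} (^-≤-fromℕ 0≤x x≤n k) ⟩
  x ℚ.* fromℕ (n ℕ.^ k)           ≤⟨ ℚ.*-monoʳ-≤-nonNeg _ {{fromℕ-nonNeg (n ℕ.^ k)}} x≤n ⟩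
  fromℕ n ℚ.* fromℕ (n ℕ.^ k)     ≡⟨ fromℕ-* n (n ℕ.^ k) ⟨
  fromℕ (n ℕ.^ suc k)             ∎
  where open ℚ.≤-Reasoning

-- If x < n, then x^k < n^k ≤ n^(k+1) ≤ x^k, a contradiction. The strict step uses k ≥ 1 and the
-- next one n ≥ 1.
n≤n^[1+1/k] : ∀ n k .{{_ : NonZero n}} .{{_ : NonZero k}} {x} → n ^[1+1/ k ]≤ x → fromℕ n ≤ x
n≤n^[1+1/k] n (suc k) {x} (0≤x , n^≤x^) = ℚ.≮⇒≥ λ x<n → ℚ.<-irrefl refl (begin-strict
  x ^ suc k                             ≤⟨ ℚ.*-monoˡ-≤-nonNeg x {{ℚ.nonNegative 0≤x}}
                                             (^-≤-fromℕ 0≤x (ℚ.<⇒≤ x<n) k) ⟩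
  x ℚ.* fromℕ (n ℕ.^ k)                 <⟨ ℚ.*-monoˡ-<-pos _ {{ℚ.normalize-pos (n ℕ.^ k) 1 {{_}} {{ℕ.m^n≢0 n k}}}} x<n ⟩
  fromℕ n ℚ.* fromℕ (n ℕ.^ k)           ≡⟨ fromℕ-* n (n ℕ.^ k) ⟨
  fromℕ (n ℕ.^ suc k)                   ≤⟨ fromℕ-mono (ℕ.m≤n*m (n ℕ.^ suc k) n) ⟩
  fromℕ (n ℕ.^ suc (suc k))             ≤⟨ n^≤x^ ⟩
  x ^ suc k                             ∎)
  where open ℚ.≤-Reasoning

-- The bound stands outside the quantifiers, so unification has to solve it by a closed expression.
-- This is what makes one polynomial serve all `n`, `O`, `F` and `k`.
costs-UniWit : Σ[ p ∈ Bound ] (∀ {n} (O : SATOracle n) (F : CNF n) k →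
               let open CostLogic O (sizeCNF F) in
               Costs (Program.uniWit (allFin n) F k) p 0 (λ _ → ⊤))
costs-UniWit = _ , λ O F k → let open CostLogic O (sizeCNF F) in
  costs-uniWit (≼-intro (ℕ.≤-reflexive (length-tabulate id))) (≼-intro ℕ.≤-refl)

time-UniWit : ∀ {n} (O : SATOracle n) (F : CNF n) k →
              time O (UniWit F k) ℕ.≤ value (proj₁ costs-UniWit) (sizeCNF F ∷ n ∷ [])
time-UniWit O F k = let open CostLogic O (sizeCNF F) in
  subst (time O (UniWit F k) ℕ.≤_) (ℕ.+-identityʳ _)
    (Within⇒time (within (runsᵗ (proj₂ costs-UniWit O F k))))

theorem3p3p4 : Σ[ p ∈ Polynomial 2 ]
    ((n k : ℕ) .{{_ : NonZero n}} .{{_ : NonZero k}}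
    (F : CNF n) (O : SATOracle n) (x : ℚ) → n ^[1+1/ k ]≤ x →
    fromℕ (time O (UniWit F k)) ≤ ⟦ p ⟧ (fromℕ (sizeCNF F) ∷ x ∷ []))
theorem3p3p4 = toPolynomial (proj₁ costs-UniWit) , λ n k F O x n^≤x →
  ℚ.≤-trans (fromℕ-mono (time-UniWit O F k))
    (value≤⟦toPolynomial⟧ (proj₁ costs-UniWit) {sizeCNF F ∷ n ∷ []} {fromℕ (sizeCNF F) ∷ x ∷ []}
      λ { zero → ℚ.≤-refl ; (suc zero) → n≤n^[1+1/k] n k n^≤x })
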